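{- Let $e(x,t)$ be a general polynomial generating function, $e(x,t)=\sum_{n\ge0}b_n(x)\,t^n/n!$ with the $b_n(x)$ polynomials in $x$, and suppose that it satisfies the binomial relation $$e(x,t)\,e(y,t)=e(x+y,t).$$ Let the linear operator $\theta$, acting on the variable $x$, be defined so that $e(x,t)$ is an eigenfunction of it: $$\theta\,e(x,t)=t\,e(x,t).$$ Then $\theta$ commutes with $D$ or, equivalently, with $E$. Explicitly, $\theta E^y e(x,t)=E^y\theta\,e(x,t)$, and by linearity this extends to arbitrary polynomials (or power series), giving the operator statement $\theta E^y=E^y\theta$.
   Context: $D=d/dx$, and $E=e^{D}$ is the unit translation operator, so that $E^y=e^{yD}$ acts by $E^yf(x)=f(x+y)$. Identities involving $t$ are formal power series identities in $t$. The operators $\theta$, $D$ and $E^y$ act on the variable $x$ and coefficientwise in $t$. The result is the converse of the fact that the polynomial sequence attached to an operator $\theta=\phi(D)$, where $\phi(D)$ is a formal power series with $\phi(D)\to D$ as $D\to0$, has an eigenfunction generating function $e(x,t)$ (that is, $\theta e(x,t)=te(x,t)$) satisfying $e(x,t)e(y,t)=e(x+y,t)$. -}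

module Defs where

open import Algebra.Apartness.Bundles using (HeytingField; HeytingCommutativeRing)
open import Algebra.Bundles using (CommutativeRing)
open import Algebra.Module.Bundles.Raw using (RawLeftModule)
import Algebra.Module.Morphism.Structures as ModuleMorphisms
import Algebra.Definitions.RawMonoid as RawMonoidDefinitions
open import Data.Fin.Base using (toℕ)
open import Data.List.Base using (List; []; _∷_; map)
open import Data.Nat.Base as ℕ using (ℕ; zero; suc)
open import Data.Product.Base using (_×_; proj₁)
open import Relation.Nullary.Negation.Core using (¬_)

-- Apartness from 0, rather than mere inequality, is what makes the positive
-- integers invertible in a Heyting field.
CharacteristicZero : ∀ {c ℓ₁ ℓ₂} → HeytingField c ℓ₁ ℓ₂ → Set ℓ₂
CharacteristicZero K = ∀ n → (suc n · 1#) # 0#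
  where
  open HeytingField K
  open CommutativeRing
    (HeytingCommutativeRing.commutativeRing heytingCommutativeRing)
    using (+-rawMonoid)
  open RawMonoidDefinitions +-rawMonoid renaming (_×_ to _·_)

module Operators {c ℓ₁ ℓ₂} (K : HeytingField c ℓ₁ ℓ₂)
                 (charZero : CharacteristicZero K) where

  open HeytingField K

  private
    R : CommutativeRing c ℓ₁
    R = HeytingCommutativeRing.commutativeRing heytingCommutativeRing

  open RawMonoidDefinitions (CommutativeRing.+-rawMonoid R) using (sum)

  -- #⇒invertible inverts (1 + n) - 0.
  1/1+_ : ℕ → Carrier
  1/1+ n = proj₁ (#⇒invertible (charZero n))

  1/_! : ℕ → Carrier
  1/ zero  ! = 1#
  1/ suc n ! = (1/1+ n) * 1/ n !

  -- Polynomials in x: a₀ ∷ a₁ ∷ … ∷ [] is a₀ + a₁ x + ….  Trailing zeros are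
  -- allowed, so equality is equality of all coefficients.
  Poly : Set c
  Poly = List Carrier

  coeff : Poly → ℕ → Carrier
  coeff []      _       = 0#
  coeff (a ∷ _) zero    = a
  coeff (_ ∷ p) (suc n) = coeff p n

  infix 4 _≈ₚ_
  _≈ₚ_ : Poly → Poly → Set ℓ₁
  p ≈ₚ q = ∀ n → coeff p n ≈ coeff q n

  infixl 6 _+ₚ_
  _+ₚ_ : Poly → Poly → Poly
  []      +ₚ q       = q
  (a ∷ p) +ₚ []      = a ∷ p
  (a ∷ p) +ₚ (b ∷ q) = (a + b) ∷ (p +ₚ q)

  infixr 7 _*ₚ_
  _*ₚ_ : Carrier → Poly → Poly
  a *ₚ p = map (a *_) p

  x·_ : Poly → Poly
  x· p = 0# ∷ p

  eval : Poly → Carrier → Carrier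
  eval []      x = 0#
  eval (a ∷ p) x = a + x * eval p x

  polyModule : RawLeftModule Carrier c ℓ₁
  polyModule = record
    { Carrierᴹ = Poly
    ; _≈ᴹ_     = _≈ₚ_
    ; _+ᴹ_     = _+ₚ_
    ; _*ₗ_     = _*ₚ_
    ; 0ᴹ       = []
    ; -ᴹ_      = map (-_)
    }

  IsLinear : (Poly → Poly) → Set _
  IsLinear = ModuleMorphisms.LeftModuleMorphisms.IsLeftModuleHomomorphism
               polyModule polyModule

  -- D = d/dx, from (a + x p)′ = p + x p′.
  D : Poly → Poly
  D []      = []
  D (a ∷ p) = p +ₚ x· D p

  -- (E^ y) p is the polynomial p(x + y), from
  -- (a + x p)(x + y) = a + (x + y) p(x + y).
  E^ : Carrier → Poly → Poly
  E^ y []      = []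
  E^ y (a ∷ p) = (a ∷ []) +ₚ (x· E^ y p +ₚ y *ₚ E^ y p)

  E : Poly → Poly
  E = E^ 1#

  Commute : (Poly → Poly) → (Poly → Poly) → Set _
  Commute S T = ∀ p → S (T p) ≈ₚ T (S p)

  -- Formal power series in t; the n-th value is the coefficient of tⁿ.
  Series : ∀ {a} → Set a → Set a
  Series A = ℕ → A

  infix 4 _≈ₛ_ _≈ₚₛ_
  _≈ₛ_ : Series Carrier → Series Carrier → Set ℓ₁
  f ≈ₛ g = ∀ n → f n ≈ g n

  _≈ₚₛ_ : Series Poly → Series Poly → Set ℓ₁
  F ≈ₚₛ G = ∀ n → F n ≈ₚ G n

  infixl 7 _*ₛ_
  _*ₛ_ : Series Carrier → Series Carrier → Series Carrier
  (f *ₛ g) n = sum {suc n} λ k → f (toℕ k) * g (n ℕ.∸ toℕ k)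

  0ₚₛ : Series Poly
  0ₚₛ _ = []

  t·_ : Series Poly → Series Poly
  (t· F) zero    = []
  (t· F) (suc n) = F n

  -- F(x , t) at a scalar x.
  _at_ : Series Poly → Carrier → Series Carrier
  (F at x) n = eval (F n) x

  -- An operator on polynomials in x, acting coefficientwise in t.
  _⟨_⟩ : (Poly → Poly) → Series Poly → Series Poly
  (T ⟨ F ⟩) n = T (F n)

  -- Σₙ bₙ(x) tⁿ / n!
  egf : (ℕ → Poly) → Series Poly
  egf b n = 1/ n ! *ₚ b n

  IsBinomial : Series Poly → Set _
  IsBinomial e = ∀ x y → (e at x) *ₛ (e at y) ≈ₛ e at (x + y)

  -- Eigenfunctions are nonzero by definition.  This matters: e = 0 satisfies the
  -- binomial relation and 0 = t · 0, but puts no constraint on θ.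
  IsEigenfunction-t : (Poly → Poly) → Series Poly → Set _
  IsEigenfunction-t θ e = ¬ (e ≈ₚₛ 0ₚₛ) × θ ⟨ e ⟩ ≈ₚₛ t· e

{-# OPTIONS --safe #-}
-- Write e = Σ pₙ(x) tⁿ.  The coefficient of y in e(x,t) e(y,t) = e(x+y,t) gives
-- D e = f(t) e, where f(t) is the derivative of e at x = 0.  Multiplication by
-- f(t) commutes with multiplication by t, so θ D and D θ agree on every pₙ.
-- Next, f(0) = 0 since D is locally nilpotent and p₀ ≠ 0; hence deg pₙ ≤ n.  The
-- degree is exactly n, because θⁿ kills p₀, …, pₙ₋₁ but sends pₙ to p₀ ≠ 0.  So
-- the pₙ span all polynomials and θ commutes with D.
--
-- For any linear T, commuting with D and with E are equivalent by Taylor's formula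
-- E^y = Σ yʲ Dʲ / j!: in one direction termwise, in the other by comparing the
-- coefficients of y in two polynomials in y that agree at all natural numbers.
module Submission where

open import Defs
open import Algebra.Apartness.Bundles using (HeytingField; HeytingCommutativeRing)
open import Algebra.Bundles using (CommutativeRing)
import Algebra.Definitions.RawMonoid as RawMonoidDefinitions
open import Algebra.Module.Bundles.Raw using (RawLeftModule)
import Algebra.Module.Morphism.Structures as ModuleMorphisms
import Algebra.Properties.Ring as RingProperties
import Algebra.Properties.Semiring.Sum as SemiringSum
import Algebra.Solver.Ring.NaturalCoefficients.Default as SemiringSolver
open import Data.Fin.Base using (Fin; zero; suc; toℕ)
open import Data.Fin.Properties using (toℕ≤pred[n])
open import Data.List.Base using (List; []; _∷_; length; applyUpTo)
open import Data.Nat.Base as ℕ using (ℕ; zero; suc; z≤n; s≤s)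
open import Data.Nat.Induction using (<-rec)
import Data.Nat.Properties as ℕ
open import Data.Product.Base using (_×_; _,_; proj₁; proj₂; ∃)
open import Data.Sum.Base using (inj₁; inj₂)
open import Function.Base using (_∘_)
open import Function.Bundles using (_⇔_; mk⇔)
open import Relation.Binary.PropositionalEquality.Core as ≡ using (_≡_)
import Relation.Binary.Reasoning.Setoid as SetoidReasoning
open import Relation.Nullary.Negation.Core using (¬_)
open import Level using (_⊔_)

module _ {c ℓ₁ ℓ₂} (K : HeytingField c ℓ₁ ℓ₂) (charZero : CharacteristicZero K) where

  open HeytingField K using (_#_; tight; #⇒invertible; heytingCommutativeRing)
  open CommutativeRing (HeytingCommutativeRing.commutativeRing heytingCommutativeRing)
    hiding (zero)
  open RingProperties ring using (-‿distribˡ-*; -1*x≈-x; -0#≈0#; x∙y⁻¹≈ε⇒x≈y; x≈y⇒x∙y⁻¹≈ε)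
  open SemiringSum semiring
    using (sum; sum-cong-≋; sum-replicate-zero)
  open RawMonoidDefinitions +-rawMonoid using () renaming (_×_ to _·_)
  open SemiringSolver commutativeSemiring using (solve; _:=_; _:+_; _:*_; con)
  open SetoidReasoning setoid
  open Operators K charZero
  open RawMonoidDefinitions (RawLeftModule.+ᴹ-rawMonoid polyModule)
    using () renaming (sum to sumₚ)

  -- Natural multiples of one and invertible scalars

  ι : ℕ → Carrier
  ι n = n · 1#

  #0⇒invertible : ∀ {a} → a # 0# → ∃ λ u → u * a ≈ 1#
  #0⇒invertible a#0 with #⇒invertible a#0
  ... | u , u[a-0]≈1 , _ =
    u , trans (*-congˡ (sym (trans (+-congˡ -0#≈0#) (+-identityʳ _)))) u[a-0]≈1

  ι-invertible : ∀ n → ∃ λ u → u * ι (suc n) ≈ 1#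
  ι-invertible n = #0⇒invertible (charZero n)

  *-cancelˡ-invertible : ∀ {u a x y} → u * a ≈ 1# → a * x ≈ a * y → x ≈ y
  *-cancelˡ-invertible {u} {a} {x} {y} ua≈1 ax≈ay = begin
    x            ≈⟨ *-identityˡ x ⟨
    1# * x       ≈⟨ *-congʳ ua≈1 ⟨
    u * a * x    ≈⟨ *-assoc u a x ⟩
    u * (a * x)  ≈⟨ *-congˡ ax≈ay ⟩
    u * (a * y)  ≈⟨ *-assoc u a y ⟨
    u * a * y    ≈⟨ *-congʳ ua≈1 ⟩
    1# * y       ≈⟨ *-identityˡ y ⟩
    y            ∎

  -- Equations are ¬¬-stable by tightness, so in proving one, a nonzero scalar may
  -- be assumed invertible.
  assume-invertible : ∀ {a x y} → ¬ (a ≈ 0#) → ((∃ λ u → u * a ≈ 1#) → x ≈ y) → x ≈ y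
  assume-invertible {a} {x} {y} a≉0 k = proj₁ (tight x y) λ x#y →
    a≉0 (proj₁ (tight a 0#) λ a#0 → proj₂ (tight x y) (k (#0⇒invertible a#0)) x#y)

  sum-zero : ∀ {n} {f : Fin n → Carrier} → (∀ i → f i ≈ 0#) → sum f ≈ 0#
  sum-zero {n} f≈0 = trans (sum-cong-≋ f≈0) (sum-replicate-zero n)

  -- Coefficients

  coeff-+ : ∀ p q n → coeff (p +ₚ q) n ≈ coeff p n + coeff q n
  coeff-+ []      q       n       = sym (+-identityˡ _)
  coeff-+ (a ∷ p) []      n       = sym (+-identityʳ _)
  coeff-+ (a ∷ p) (b ∷ q) zero    = refl
  coeff-+ (a ∷ p) (b ∷ q) (suc n) = coeff-+ p q n

  coeff-* : ∀ a p n → coeff (a *ₚ p) n ≈ a * coeff p n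
  coeff-* a []      n       = sym (zeroʳ a)
  coeff-* a (b ∷ p) zero    = refl
  coeff-* a (b ∷ p) (suc n) = coeff-* a p n

  coeff-D : ∀ p n → coeff (D p) n ≈ ι (suc n) * coeff p (suc n)
  coeff-D []      n       = sym (zeroʳ _)
  coeff-D (a ∷ p) zero    = begin
    coeff (p +ₚ x· D p) 0  ≈⟨ coeff-+ p (x· D p) 0 ⟩
    coeff p 0 + 0#         ≈⟨ solve 1 (λ c → c :+ con 0 := (con 1 :+ con 0) :* c) refl _ ⟩
    ι 1 * coeff p 0        ∎
  coeff-D (a ∷ p) (suc n) = begin
    coeff (p +ₚ x· D p) (suc n)                         ≈⟨ coeff-+ p (x· D p) (suc n) ⟩
    coeff p (suc n) + coeff (D p) n                     ≈⟨ +-congˡ (coeff-D p n) ⟩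
    coeff p (suc n) + ι (suc n) * coeff p (suc n)       ≈⟨ +-congʳ (*-identityˡ _) ⟨
    1# * coeff p (suc n) + ι (suc n) * coeff p (suc n)  ≈⟨ distribʳ _ _ _ ⟨
    ι (suc (suc n)) * coeff p (suc n)                   ∎

  coeff-sum : ∀ {n} (ps : Fin n → Poly) m → coeff (sumₚ ps) m ≈ sum (λ i → coeff (ps i) m)
  coeff-sum {zero}  ps m = refl
  coeff-sum {suc n} ps m =
    trans (coeff-+ (ps zero) _ m) (+-congˡ (coeff-sum (ps ∘ suc) m))

  coeff-vanishes : ∀ p {n} → length p ℕ.≤ n → coeff p n ≈ 0#
  coeff-vanishes []      _         = refl
  coeff-vanishes (a ∷ p) (s≤s p≤n) = coeff-vanishes p p≤n

  -- Polynomials are determined by their values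

  eval-cong : ∀ p q x → p ≈ₚ q → eval p x ≈ eval q x
  eval-cong []      []      x p≈q = refl
  eval-cong []      (b ∷ q) x p≈q = begin
    0#              ≈⟨ solve 1 (λ x → con 0 := con 0 :+ x :* con 0) refl x ⟩
    0# + x * 0#     ≈⟨ +-cong (p≈q 0) (*-congˡ (eval-cong [] q x (p≈q ∘ suc))) ⟩
    b + x * eval q x ∎
  eval-cong (a ∷ p) []      x p≈q = begin
    a + x * eval p x ≈⟨ +-cong (p≈q 0) (*-congˡ (eval-cong p [] x (p≈q ∘ suc))) ⟩
    0# + x * 0#     ≈⟨ solve 1 (λ x → con 0 :+ x :* con 0 := con 0) refl x ⟩
    0#              ∎
  eval-cong (a ∷ p) (b ∷ q) x p≈q =
    +-cong (p≈q 0) (*-congˡ (eval-cong p q x (p≈q ∘ suc)))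

  eval-congʳ : ∀ p {x y} → x ≈ y → eval p x ≈ eval p y
  eval-congʳ []      x≈y = refl
  eval-congʳ (a ∷ p) x≈y = +-congˡ (*-cong x≈y (eval-congʳ p x≈y))

  eval-+ : ∀ p q x → eval (p +ₚ q) x ≈ eval p x + eval q x
  eval-+ []      q       x = sym (+-identityˡ _)
  eval-+ (a ∷ p) []      x = sym (+-identityʳ _)
  eval-+ (a ∷ p) (b ∷ q) x = begin
    a + b + x * eval (p +ₚ q) x              ≈⟨ +-congˡ (*-congˡ (eval-+ p q x)) ⟩
    a + b + x * (eval p x + eval q x)        ≈⟨ solve 5 (λ a b x p q →
      a :+ b :+ x :* (p :+ q) := a :+ x :* p :+ (b :+ x :* q)) refl a b x _ _ ⟩
    a + x * eval p x + (b + x * eval q x)    ∎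

  eval-* : ∀ a p x → eval (a *ₚ p) x ≈ a * eval p x
  eval-* a []      x = sym (zeroʳ a)
  eval-* a (b ∷ p) x = begin
    a * b + x * eval (a *ₚ p) x  ≈⟨ +-congˡ (*-congˡ (eval-* a p x)) ⟩
    a * b + x * (a * eval p x)   ≈⟨ solve 4 (λ a b x p →
      a :* b :+ x :* (a :* p) := a :* (b :+ x :* p)) refl a b x _ ⟩
    a * (b + x * eval p x)       ∎

  eval-sum : ∀ {n} (ps : Fin n → Poly) x → eval (sumₚ ps) x ≈ sum (λ i → eval (ps i) x)
  eval-sum {zero}  ps x = refl
  eval-sum {suc n} ps x =
    trans (eval-+ (ps zero) _ x) (+-congˡ (eval-sum (ps ∘ suc) x))

  -- The quotient of a + x p(x) by x - r; it does not depend on a.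
  quotient : Carrier → Poly → Poly
  quotient r []      = []
  quotient r (b ∷ p) = eval (b ∷ p) r ∷ quotient r p

  length-quotient : ∀ r p → length (quotient r p) ≡ length p
  length-quotient r []      = ≡.refl
  length-quotient r (b ∷ p) = ≡.cong suc (length-quotient r p)

  -- Division with remainder, taken at the point x = r + d. Writing d for x - r keeps the identity
  -- free of subtraction, so the semiring solver applies.
  eval-quotient : ∀ r d p →
    (r + d) * eval p (r + d) ≈ r * eval p r + d * eval (quotient r p) (r + d)
  eval-quotient r d []      = solve 2 (λ r d →
    (r :+ d) :* con 0 := r :* con 0 :+ d :* con 0) refl r d
  eval-quotient r d (b ∷ p) = begin
    (r + d) * (b + (r + d) * eval p (r + d))
      ≈⟨ *-congˡ (+-congˡ (eval-quotient r d p)) ⟩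
    (r + d) * (b + (r * eval p r + d * eval (quotient r p) (r + d)))
      ≈⟨ solve 5 (λ r d b u v →
           (r :+ d) :* (b :+ (r :* u :+ d :* v))
             := r :* (b :+ r :* u) :+ d :* (b :+ r :* u :+ (r :+ d) :* v))
           refl r d b _ _ ⟩
    r * (b + r * eval p r) + d * (b + r * eval p r + (r + d) * eval (quotient r p) (r + d)) ∎

  -- The tail of the quotient is the quotient of the tail, so coefficients are recovered from the
  -- top down; once the tail is zero, the head b + r p(r) of the quotient is just b.
  quotient-zero : ∀ r p → quotient r p ≈ₚ [] → p ≈ₚ []
  quotient-zero r []      q≈0         = q≈0
  quotient-zero r (b ∷ p) q≈0 (suc n) = quotient-zero r p (q≈0 ∘ suc) n
  quotient-zero r (b ∷ p) q≈0 zero    = begin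
    b                 ≈⟨ solve 2 (λ b r → b := b :+ r :* con 0) refl b r ⟩
    b + r * 0#        ≈⟨ +-congˡ (*-congˡ (eval-cong p [] r (quotient-zero r p (q≈0 ∘ suc)))) ⟨
    b + r * eval p r  ≈⟨ q≈0 0 ⟩
    0#                ∎

  -- Dividing out the root r leaves a shorter list that vanishes at r + 1, r + 2, and so on, since
  -- the distances 1, 2, ... to r are invertible. The starting point is a parameter so that the
  -- induction can move to r + 1; it runs on the length because the quotient is not a subterm.
  eval-zero⇒zero : ∀ k p → length p ≡ k → ∀ r → (∀ n → eval p (r + ι n) ≈ 0#) → p ≈ₚ []
  eval-zero⇒zero k       []      _  r p≈0 _ = refl
  eval-zero⇒zero (suc k) (a ∷ p) eq r p≈0   = λ
    { zero → begin
        a                 ≈⟨ solve 2 (λ a r → a := a :+ r :* con 0) refl a r ⟩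
        a + r * 0#        ≈⟨ +-congˡ (*-congˡ (eval-cong p [] r tail≈0)) ⟨
        a + r * eval p r  ≈⟨ value≈0 ⟩
        0#                ∎
    ; (suc n) → tail≈0 n
    }
    where
    value≈0 : eval (a ∷ p) r ≈ 0#
    value≈0 = trans (eval-congʳ (a ∷ p) (sym (+-identityʳ r))) (p≈0 0)

    quotient≈0 : ∀ n → eval (quotient r p) (r + 1# + ι n) ≈ 0#
    quotient≈0 n = trans (eval-congʳ (quotient r p) (+-assoc r 1# (ι n)))
      (*-cancelˡ-invertible (proj₂ (ι-invertible n)) (begin
        d * Q                       ≈⟨ +-identityˡ _ ⟨
        0# + d * Q                  ≈⟨ +-congʳ value≈0 ⟨
        a + r * eval p r + d * Q    ≈⟨ +-assoc _ _ _ ⟩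
        a + (r * eval p r + d * Q)  ≈⟨ +-congˡ (eval-quotient r d p) ⟨
        eval (a ∷ p) (r + d)        ≈⟨ p≈0 (suc n) ⟩
        0#                          ≈⟨ zeroʳ d ⟨
        d * 0#                      ∎))
      where
      d = ι (suc n)
      Q = eval (quotient r p) (r + d)

    tail≈0 : p ≈ₚ []
    tail≈0 = quotient-zero r p (eval-zero⇒zero k (quotient r p)
      (≡.trans (length-quotient r p) (ℕ.suc-injective eq)) (r + 1#) quotient≈0)

  -- Commutation with `E` alone gives information only at natural numbers, hence this form rather
  -- than agreement at every scalar.
  eval-ι-injective : ∀ p q → (∀ n → eval p (ι n) ≈ eval q (ι n)) → p ≈ₚ q
  eval-ι-injective p q p≈q n = x∙y⁻¹≈ε⇒x≈y _ _ (begin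
    coeff p n - coeff q n            ≈⟨ +-congˡ (-1*x≈-x _) ⟨
    coeff p n + (- 1#) * coeff q n   ≈⟨ +-congˡ (coeff-* (- 1#) q n) ⟨
    coeff p n + coeff (- 1# *ₚ q) n  ≈⟨ coeff-+ p _ n ⟨
    coeff (p +ₚ (- 1#) *ₚ q) n       ≈⟨ eval-zero⇒zero _ (p +ₚ (- 1#) *ₚ q) ≡.refl 0# difference≈0 n ⟩
    0#                               ∎)
    where
    difference≈0 : ∀ n → eval (p +ₚ (- 1#) *ₚ q) (0# + ι n) ≈ 0#
    difference≈0 n = begin
      eval (p +ₚ (- 1#) *ₚ q) (0# + ι n)        ≈⟨ eval-congʳ (p +ₚ (- 1#) *ₚ q) (+-identityˡ _) ⟩
      eval (p +ₚ (- 1#) *ₚ q) (ι n)             ≈⟨ eval-+ p _ _ ⟩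
      eval p (ι n) + eval ((- 1#) *ₚ q) (ι n)   ≈⟨ +-congˡ (eval-* (- 1#) q _) ⟩
      eval p (ι n) + (- 1#) * eval q (ι n)      ≈⟨ +-congˡ (-1*x≈-x _) ⟩
      eval p (ι n) - eval q (ι n)               ≈⟨ x≈y⇒x∙y⁻¹≈ε (p≈q n) ⟩
      0#                                        ∎

  eval-injective : ∀ p q → (∀ x → eval p x ≈ eval q x) → p ≈ₚ q
  eval-injective p q p≈q = eval-ι-injective p q (p≈q ∘ ι)

  -- Linear operators and functionals

  module Linear {T : Poly → Poly} (linear : IsLinear T) where
    open ModuleMorphisms.LeftModuleMorphisms.IsLeftModuleHomomorphism linear public

    T-cong : ∀ p q → p ≈ₚ q → T p ≈ₚ T q
    T-cong p q p≈q = ⟦⟧-cong {p} {q} p≈q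

    T-sum : ∀ {n} (ps : Fin n → Poly) → T (sumₚ ps) ≈ₚ sumₚ (T ∘ ps)
    T-sum {zero}  ps   = 0ᴹ-homo
    T-sum {suc n} ps m = begin
      coeff (T (sumₚ ps)) m                                ≈⟨ +ᴹ-homo (ps zero) (sumₚ (ps ∘ suc)) m ⟩
      coeff (T (ps zero) +ₚ T (sumₚ (ps ∘ suc))) m         ≈⟨ coeff-+ (T (ps zero)) _ m ⟩
      coeff (T (ps zero)) m + coeff (T (sumₚ (ps ∘ suc))) m ≈⟨ +-congˡ (T-sum (ps ∘ suc) m) ⟩
      coeff (T (ps zero)) m + coeff (sumₚ (T ∘ ps ∘ suc)) m ≈⟨ coeff-+ (T (ps zero)) (sumₚ (T ∘ ps ∘ suc)) m ⟨
      coeff (sumₚ (T ∘ ps)) m                              ∎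

  -- Operator identities are tested one coefficient at a time. An induction can then absorb a
  -- multiplication by x or an operator into the functional.
  record LinearFunctional (L : Poly → Carrier) : Set (c ⊔ ℓ₁) where
    field
      cong    : ∀ p q → p ≈ₚ q → L p ≈ L q
      +-homo  : ∀ p q → L (p +ₚ q) ≈ L p + L q
      *-homo  : ∀ a p → L (a *ₚ p) ≈ a * L p

    zero-homo : L [] ≈ 0#
    zero-homo = trans (*-homo 0# []) (zeroˡ _)

  open LinearFunctional

  coeff-linear : ∀ m → LinearFunctional (λ p → coeff p m)
  coeff-linear m = record
    { cong   = λ p q p≈q → p≈q m
    ; +-homo = λ p q → coeff-+ p q m
    ; *-homo = λ a p → coeff-* a p m
    }

  ∘-linear : ∀ {L T} → LinearFunctional L → IsLinear T → LinearFunctional (L ∘ T)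
  ∘-linear {L} {T} l t = record
    { cong   = λ p q p≈q → cong l _ _ (T-cong p q p≈q)
    ; +-homo = λ p q → trans (cong l _ _ (+ᴹ-homo p q)) (+-homo l _ _)
    ; *-homo = λ a p → trans (cong l _ _ (*ₗ-homo a p)) (*-homo l _ _)
    }
    where open Linear t

  x·-linear : ∀ {L} → LinearFunctional L → LinearFunctional (L ∘ x·_)
  x·-linear l = record
    { cong   = λ p q p≈q → cong l _ _ λ { zero → refl ; (suc n) → p≈q n }
    ; +-homo = λ p q → trans
        (cong l _ _ λ { zero → sym (+-identityˡ 0#) ; (suc n) → refl }) (+-homo l _ _)
    ; *-homo = λ a p → trans
        (cong l _ _ λ { zero → sym (zeroʳ a) ; (suc n) → refl }) (*-homo l _ _)
    }

  D-cong : ∀ p q → p ≈ₚ q → D p ≈ₚ D q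
  D-cong p q p≈q n =
    trans (coeff-D p n) (trans (*-congˡ (p≈q (suc n))) (sym (coeff-D q n)))

  D-+ : ∀ p q → D (p +ₚ q) ≈ₚ D p +ₚ D q
  D-+ p q n = begin
    coeff (D (p +ₚ q)) n                                       ≈⟨ coeff-D (p +ₚ q) n ⟩
    ι (suc n) * coeff (p +ₚ q) (suc n)                         ≈⟨ *-congˡ (coeff-+ p q (suc n)) ⟩
    ι (suc n) * (coeff p (suc n) + coeff q (suc n))            ≈⟨ distribˡ _ _ _ ⟩
    ι (suc n) * coeff p (suc n) + ι (suc n) * coeff q (suc n)  ≈⟨ +-cong (coeff-D p n) (coeff-D q n) ⟨
    coeff (D p) n + coeff (D q) n                              ≈⟨ coeff-+ (D p) (D q) n ⟨
    coeff (D p +ₚ D q) n                                       ∎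

  D-* : ∀ a p → D (a *ₚ p) ≈ₚ a *ₚ D p
  D-* a p n = begin
    coeff (D (a *ₚ p)) n                ≈⟨ coeff-D (a *ₚ p) n ⟩
    ι (suc n) * coeff (a *ₚ p) (suc n)  ≈⟨ *-congˡ (coeff-* a p (suc n)) ⟩
    ι (suc n) * (a * coeff p (suc n))   ≈⟨ solve 3 (λ i a c → i :* (a :* c) := a :* (i :* c)) refl _ a _ ⟩
    a * (ι (suc n) * coeff p (suc n))   ≈⟨ *-congˡ (coeff-D p n) ⟨
    a * coeff (D p) n                   ≈⟨ coeff-* a (D p) n ⟨
    coeff (a *ₚ D p) n                  ∎

  ∘D-linear : ∀ {L} → LinearFunctional L → LinearFunctional (L ∘ D)
  ∘D-linear l = record
    { cong   = λ p q p≈q → cong l _ _ (D-cong p q p≈q)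
    ; +-homo = λ p q → trans (cong l _ _ (D-+ p q)) (+-homo l _ _)
    ; *-homo = λ a p → trans (cong l _ _ (D-* a p)) (*-homo l _ _)
    }

  -- Turns the equality of two functionals into the vanishing of one, the form that `spans`
  -- requires.
  -‿linear : ∀ {L M} → LinearFunctional L → LinearFunctional M →
             LinearFunctional (λ p → L p + (- 1#) * M p)
  -‿linear l m = record
    { cong   = λ p q p≈q → +-cong (cong l p q p≈q) (*-congˡ (cong m p q p≈q))
    ; +-homo = λ p q → trans (+-cong (+-homo l p q) (*-congˡ (+-homo m p q)))
        (solve 5 (λ s u v w z → (u :+ v) :+ s :* (w :+ z) := (u :+ s :* w) :+ (v :+ s :* z)) refl _ _ _ _ _)
    ; *-homo = λ a p → trans (+-cong (*-homo l a p) (*-congˡ (*-homo m a p)))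
        (solve 4 (λ s a u w → a :* u :+ s :* (a :* w) := a :* (u :+ s :* w)) refl _ _ _ _)
    }

  -- Translation

  eval-E^ : ∀ y p x → eval (E^ y p) x ≈ eval p (x + y)
  eval-E^ y []      x = refl
  eval-E^ y (a ∷ p) x = begin
    eval ((a ∷ []) +ₚ (x· E^ y p +ₚ y *ₚ E^ y p)) x
      ≈⟨ trans (eval-+ (a ∷ []) (x· E^ y p +ₚ y *ₚ E^ y p) x)
           (+-congˡ (trans (eval-+ (x· E^ y p) (y *ₚ E^ y p) x) (+-congˡ (eval-* y (E^ y p) x)))) ⟩
    a + x * 0# + (0# + x * eval (E^ y p) x + y * eval (E^ y p) x)
      ≈⟨ solve 4 (λ a x y q →
           a :+ x :* con 0 :+ (con 0 :+ x :* q :+ y :* q) := a :+ (x :+ y) :* q) refl a x y _ ⟩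
    a + (x + y) * eval (E^ y p) x
      ≈⟨ +-congˡ (*-congˡ (eval-E^ y p x)) ⟩
    a + (x + y) * eval p (x + y) ∎

  E^-cong : ∀ y p q → p ≈ₚ q → E^ y p ≈ₚ E^ y q
  E^-cong y p q p≈q = eval-injective (E^ y p) (E^ y q) λ x →
    trans (eval-E^ y p x) (trans (eval-cong p q (x + y) p≈q) (sym (eval-E^ y q x)))

  E^-zero : ∀ p → E^ 0# p ≈ₚ p
  E^-zero p = eval-injective (E^ 0# p) p λ x →
    trans (eval-E^ 0# p x) (eval-congʳ p (+-identityʳ x))

  E^-1+ : ∀ y p → E^ (1# + y) p ≈ₚ E (E^ y p)
  E^-1+ y p = eval-injective (E^ (1# + y) p) (E (E^ y p)) λ x → begin
    eval (E^ (1# + y) p) x  ≈⟨ eval-E^ (1# + y) p x ⟩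
    eval p (x + (1# + y))   ≈⟨ eval-congʳ p (+-assoc x 1# y) ⟨
    eval p (x + 1# + y)     ≈⟨ eval-E^ y p (x + 1#) ⟨
    eval (E^ y p) (x + 1#)  ≈⟨ eval-E^ 1# (E^ y p) x ⟨
    eval (E (E^ y p)) x     ∎

  coeff-E^ : ∀ y a p m → coeff (E^ y (a ∷ p)) m ≈
    coeff (a ∷ []) m + (coeff (x· E^ y p) m + y * coeff (E^ y p) m)
  coeff-E^ y a p m = trans (coeff-+ (a ∷ []) (x· E^ y p +ₚ y *ₚ E^ y p) m)
    (+-congˡ (trans (coeff-+ (x· E^ y p) (y *ₚ E^ y p) m) (+-congˡ (coeff-* y (E^ y p) m))))

  coeff₀-E^ : ∀ y p → coeff (E^ y p) 0 ≈ eval p y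
  coeff₀-E^ y []      = refl
  coeff₀-E^ y (a ∷ p) = trans (coeff-E^ y a p 0)
    (+-congˡ (trans (+-identityˡ _) (*-congˡ (coeff₀-E^ y p))))

  -- This is the term of p(x + y) linear in x; through it the derivative enters the binomial
  -- relation.
  coeff₁-E^ : ∀ y p → coeff (E^ y p) 1 ≈ eval (D p) y
  coeff₁-E^ y []      = refl
  coeff₁-E^ y (a ∷ p) = begin
    coeff (E^ y (a ∷ p)) 1                                ≈⟨ coeff-E^ y a p 1 ⟩
    0# + (coeff (E^ y p) 0 + y * coeff (E^ y p) 1)        ≈⟨ +-identityˡ _ ⟩
    coeff (E^ y p) 0 + y * coeff (E^ y p) 1               ≈⟨ +-cong (coeff₀-E^ y p) (*-congˡ (coeff₁-E^ y p)) ⟩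
    eval p y + y * eval (D p) y                           ≈⟨ +-congˡ (+-identityˡ _) ⟨
    eval p y + eval (x· D p) y                            ≈⟨ eval-+ p (x· D p) y ⟨
    eval (p +ₚ x· D p) y                                  ∎

  -- Taylor's formula

  -- The Hasse derivative Dʲ / j!.
  H : ℕ → Poly → Poly
  H zero    p       = p
  H (suc j) []      = []
  H (suc j) (a ∷ p) = H j p +ₚ x· H (suc j) p

  H₁≡D : ∀ p → H 1 p ≡ D p
  H₁≡D []      = ≡.refl
  H₁≡D (a ∷ p) = ≡.cong (λ q → p +ₚ x· q) (H₁≡D p)

  -- Together with `H 0` being the identity, this determines `H j` as Dʲ / j! without any division
  -- by factorials.
  D-H : ∀ j p → D (H j p) ≈ₚ ι (suc j) *ₚ H (suc j) p
  D-H zero    p       n = begin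
    coeff (D p) n             ≡⟨ ≡.cong (λ q → coeff q n) (H₁≡D p) ⟨
    coeff (H 1 p) n           ≈⟨ solve 1 (λ c → c := (con 1 :+ con 0) :* c) refl _ ⟩
    ι 1 * coeff (H 1 p) n     ≈⟨ coeff-* (ι 1) (H 1 p) n ⟨
    coeff (ι 1 *ₚ H 1 p) n    ∎
  D-H (suc j) []      n = refl
  D-H (suc j) (a ∷ p) n = begin
    coeff (D (H j p +ₚ x· q)) n
      ≈⟨ D-+ (H j p) (x· q) n ⟩
    coeff (D (H j p) +ₚ (q +ₚ x· D q)) n
      ≈⟨ trans (coeff-+ (D (H j p)) _ n) (+-cong (D-H j p n) (coeff-+ q _ n)) ⟩
    coeff (ι (suc j) *ₚ q) n + (coeff q n + coeff (x· D q) n)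
      ≈⟨ +-cong (coeff-* (ι (suc j)) q n) (+-congˡ (shifted n)) ⟩
    ι (suc j) * coeff q n + (coeff q n + ι (suc (suc j)) * coeff (x· r) n)
      ≈⟨ solve 3 (λ i u v → i :* u :+ (u :+ (con 1 :+ i) :* v) := (con 1 :+ i) :* (u :+ v)) refl _ _ _ ⟩
    ι (suc (suc j)) * (coeff q n + coeff (x· r) n)
      ≈⟨ *-congˡ (coeff-+ q (x· r) n) ⟨
    ι (suc (suc j)) * coeff (q +ₚ x· r) n
      ≈⟨ coeff-* _ (q +ₚ x· r) n ⟨
    coeff (ι (suc (suc j)) *ₚ (q +ₚ x· r)) n ∎
    where
    q = H (suc j) p
    r = H (suc (suc j)) p

    shifted : ∀ n → coeff (x· D q) n ≈ ι (suc (suc j)) * coeff (x· r) n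
    shifted zero    = sym (zeroʳ _)
    shifted (suc n) = trans (D-H (suc j) p n) (coeff-* _ r n)

  -- Here `applyUpTo f N` serves as the polynomial in y with coefficients f 0, ..., f (N - 1).
  eval-applyUpTo-cong : ∀ {f g : ℕ → Carrier} → (∀ j → f j ≈ g j) → ∀ N y →
    eval (applyUpTo f N) y ≈ eval (applyUpTo g N) y
  eval-applyUpTo-cong f≈g zero    y = refl
  eval-applyUpTo-cong f≈g (suc N) y =
    +-cong (f≈g 0) (*-congˡ (eval-applyUpTo-cong (f≈g ∘ suc) N y))

  eval-applyUpTo-+ : ∀ (f g : ℕ → Carrier) N y →
    eval (applyUpTo (λ j → f j + g j) N) y ≈ eval (applyUpTo f N) y + eval (applyUpTo g N) y
  eval-applyUpTo-+ f g zero    y = sym (+-identityˡ 0#)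
  eval-applyUpTo-+ f g (suc N) y = trans
    (+-congˡ (*-congˡ (eval-applyUpTo-+ (f ∘ suc) (g ∘ suc) N y)))
    (solve 5 (λ a b y u v → (a :+ b) :+ y :* (u :+ v) := (a :+ y :* u) :+ (b :+ y :* v)) refl _ _ _ _ _)

  eval-applyUpTo-zero : ∀ {f : ℕ → Carrier} → (∀ j → f j ≈ 0#) → ∀ N y →
    eval (applyUpTo f N) y ≈ 0#
  eval-applyUpTo-zero f≈0 zero    y = refl
  eval-applyUpTo-zero f≈0 (suc N) y = trans
    (+-cong (f≈0 0) (*-congˡ (eval-applyUpTo-zero (f≈0 ∘ suc) N y)))
    (solve 1 (λ y → con 0 :+ y :* con 0 := con 0) refl y)

  H-[] : ∀ j → H j [] ≡ []
  H-[] zero    = ≡.refl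
  H-[] (suc j) = ≡.refl

  -- Induction on a + x p: generality in `L` lets the factor x pass into the functional. Any `N`
  -- bounding the length is allowed, so that p and its image under an operator can share one
  -- truncation.
  taylor : ∀ {L} → LinearFunctional L → ∀ y p N → length p ℕ.≤ N →
    L (E^ y p) ≈ eval (applyUpTo (λ j → L (H j p)) N) y
  taylor {L} l y []      N       _         = trans (zero-homo l) (sym (eval-applyUpTo-zero
    (λ j → trans (reflexive (≡.cong L (H-[] j))) (zero-homo l)) N y))
  taylor {L} l y (a ∷ p) (suc N) (s≤s p≤N) = begin
    L ((a ∷ []) +ₚ (x· q +ₚ y *ₚ q))
      ≈⟨ trans (+-homo l _ _) (+-congˡ (trans (+-homo l _ _) (+-congˡ (*-homo l y q)))) ⟩
    L (a ∷ []) + (L (x· q) + y * L q)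
      -- The summand with the factor y is truncated one step earlier. The other expansion, at
      -- `suc N`, unfolds to its term j = 0 plus y times `V`.
      ≈⟨ +-congˡ (+-cong (taylor (x·-linear l) y p (suc N) (ℕ.m≤n⇒m≤1+n p≤N))
                         (*-congˡ (taylor l y p N p≤N))) ⟩
    L (a ∷ []) + (L (x· p) + y * V + y * U)
      ≈⟨ solve 5 (λ a p y u v → a :+ (p :+ y :* v :+ y :* u) := a :+ p :+ y :* (u :+ v)) refl _ _ y U V ⟩
    L (a ∷ []) + L (x· p) + y * (U + V)
      ≈⟨ +-cong (+-homo l (a ∷ []) (x· p)) (*-congˡ (eval-applyUpTo-+ _ _ N y)) ⟨
    L ((a + 0#) ∷ p) + y * eval (applyUpTo (λ j → L (H j p) + L (x· H (suc j) p)) N) y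
      ≈⟨ +-cong (cong l _ _ λ { zero → sym (+-identityʳ a) ; (suc n) → refl })
                (*-congˡ (eval-applyUpTo-cong (λ j → +-homo l (H j p) (x· H (suc j) p)) N y)) ⟨
    L (a ∷ p) + y * eval (applyUpTo (λ j → L (H (suc j) (a ∷ p))) N) y ∎
    where
    q = E^ y p
    U = eval (applyUpTo (λ j → L (H j p)) N) y
    V = eval (applyUpTo (λ j → L (x· H (suc j) p)) N) y

  -- Commuting with D and commuting with translations

  module _ {T : Poly → Poly} (linear : IsLinear T) where
    open Linear linear

    -- Induction by `D-H`: commutation is shown after multiplication by j + 1, which is then
    -- cancelled.
    commute-D⇒commute-H : Commute T D → ∀ j → Commute T (H j)
    commute-D⇒commute-H TD≈DT zero    p n = refl
    commute-D⇒commute-H TD≈DT (suc j) p n = *-cancelˡ-invertible (proj₂ (ι-invertible j)) (begin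
      ι (suc j) * coeff (T (H (suc j) p)) n      ≈⟨ coeff-* (ι (suc j)) (T (H (suc j) p)) n ⟨
      coeff (ι (suc j) *ₚ T (H (suc j) p)) n     ≈⟨ *ₗ-homo (ι (suc j)) (H (suc j) p) n ⟨
      coeff (T (ι (suc j) *ₚ H (suc j) p)) n     ≈⟨ T-cong _ _ (D-H j p) n ⟨
      coeff (T (D (H j p))) n                    ≈⟨ TD≈DT (H j p) n ⟩
      coeff (D (T (H j p))) n                    ≈⟨ D-cong (T (H j p)) (H j (T p)) (commute-D⇒commute-H TD≈DT j p) n ⟩
      coeff (D (H j (T p))) n                    ≈⟨ D-H j (T p) n ⟩
      coeff (ι (suc j) *ₚ H (suc j) (T p)) n     ≈⟨ coeff-* (ι (suc j)) (H (suc j) (T p)) n ⟩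
      ι (suc j) * coeff (H (suc j) (T p)) n      ∎)

    commute-D⇒commute-E^ : Commute T D → ∀ y → Commute T (E^ y)
    commute-D⇒commute-E^ TD≈DT y p m = begin
      coeff (T (E^ y p)) m
        ≈⟨ taylor (∘-linear (coeff-linear m) linear) y p N (ℕ.m≤m+n _ _) ⟩
      eval (applyUpTo (λ j → coeff (T (H j p)) m) N) y
        ≈⟨ eval-applyUpTo-cong (λ j → commute-D⇒commute-H TD≈DT j p m) N y ⟩
      eval (applyUpTo (λ j → coeff (H j (T p)) m) N) y
        ≈⟨ taylor (coeff-linear m) y (T p) N (ℕ.m≤n+m _ _) ⟨
      coeff (E^ y (T p)) m ∎
      where N = length p ℕ.+ length (T p)

    commute-E⇒commute-E^ι : Commute T E → ∀ n → Commute T (E^ (ι n))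
    commute-E⇒commute-E^ι TE≈ET zero    p m =
      trans (T-cong _ _ (E^-zero p) m) (sym (E^-zero (T p) m))
    commute-E⇒commute-E^ι TE≈ET (suc n) p m = begin
      coeff (T (E^ (ι (suc n)) p)) m  ≈⟨ T-cong _ _ (E^-1+ (ι n) p) m ⟩
      coeff (T (E (E^ (ι n) p))) m    ≈⟨ TE≈ET (E^ (ι n) p) m ⟩
      coeff (E (T (E^ (ι n) p))) m    ≈⟨ E^-cong 1# (T (E^ (ι n) p)) (E^ (ι n) (T p)) (commute-E⇒commute-E^ι TE≈ET n p) m ⟩
      coeff (E (E^ (ι n) (T p))) m    ≈⟨ E^-1+ (ι n) (T p) m ⟨
      coeff (E^ (ι (suc n)) (T p)) m  ∎

    -- For fixed p and m, the coefficients of xᵐ in T E^y p and E^y T p are polynomials in y. They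
    -- agree at each natural y, where E^y is an iterate of `E`.
    commute-E⇒commute-D : Commute T E → Commute T D
    commute-E⇒commute-D TE≈ET p m = begin
      coeff (T (D p)) m    ≡⟨ ≡.cong (λ q → coeff (T q) m) (H₁≡D p) ⟨
      -- The final argument 1 selects the coefficient of y.
      coeff (T (H 1 p)) m  ≈⟨ eval-ι-injective
        (applyUpTo (λ j → coeff (T (H j p)) m) N) (applyUpTo (λ j → coeff (H j (T p)) m) N) agree 1 ⟩
      coeff (H 1 (T p)) m  ≡⟨ ≡.cong (λ q → coeff q m) (H₁≡D (T p)) ⟩
      coeff (D (T p)) m    ∎
      where
      -- At least 2, so that the truncations reach the coefficient of y.
      N = 2 ℕ.+ (length p ℕ.+ length (T p))

      agree : ∀ n → eval (applyUpTo (λ j → coeff (T (H j p)) m) N) (ι n) ≈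
                    eval (applyUpTo (λ j → coeff (H j (T p)) m) N) (ι n)
      agree n = begin
        eval (applyUpTo (λ j → coeff (T (H j p)) m) N) (ι n)
          ≈⟨ taylor (∘-linear (coeff-linear m) linear) (ι n) p N
               (ℕ.≤-trans (ℕ.m≤m+n _ _) (ℕ.m≤n+m _ 2)) ⟨
        coeff (T (E^ (ι n) p)) m
          ≈⟨ commute-E⇒commute-E^ι TE≈ET n p m ⟩
        coeff (E^ (ι n) (T p)) m
          ≈⟨ taylor (coeff-linear m) (ι n) (T p) N
               (ℕ.≤-trans (ℕ.m≤n+m _ (length p)) (ℕ.m≤n+m _ 2)) ⟩
        eval (applyUpTo (λ j → coeff (H j (T p)) m) N) (ι n) ∎

  -- Polynomial sequences of binomial type

  -- Elimination from the top coefficient down. The conclusion is an equation about a functional,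
  -- not an explicit linear combination: the leading coefficients are only known to be nonzero, and
  -- their inverses may be assumed only while proving an equation. The hypotheses stop below n so
  -- that `leading≉0` can use this inside its own induction.
  spans : ∀ (p : ℕ → Poly) → (∀ n {m} → n ℕ.< m → coeff (p n) m ≈ 0#) →
    ∀ {L} → LinearFunctional L → ∀ n →
    (∀ {k} → k ℕ.< n → ¬ (coeff (p k) k ≈ 0#)) → (∀ {k} → k ℕ.< n → L (p k) ≈ 0#) →
    ∀ q → (∀ {m} → n ℕ.≤ m → coeff q m ≈ 0#) → L q ≈ 0#
  spans p deg l zero    lead L≈0 q q≈0 = trans (cong l q [] (λ m → q≈0 z≤n)) (zero-homo l)
  spans p deg {L} l (suc n) lead L≈0 q q≈0 =
    assume-invertible (lead (ℕ.n<1+n n)) eliminate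
    where
    eliminate : (∃ λ u → u * coeff (p n) n ≈ 1#) → L q ≈ 0#
    eliminate (u , u*lead≈1) = begin
      L q                  ≈⟨ +-identityʳ _ ⟨
      L q + 0#             ≈⟨ +-congˡ (trans (*-congˡ (L≈0 (ℕ.n<1+n n))) (zeroʳ s)) ⟨
      L q + s * L (p n)    ≈⟨ +-congˡ (*-homo l s (p n)) ⟨
      L q + L (s *ₚ p n)   ≈⟨ +-homo l q _ ⟨
      L q′                 ≈⟨ spans p deg l n (lead ∘ ℕ.m<n⇒m<1+n) (L≈0 ∘ ℕ.m<n⇒m<1+n) q′ q′-vanishes ⟩
      0#                   ∎
      where
      -- Chosen so that adding `s *ₚ p n` cancels the coefficient of xⁿ in q.
      s  = - (coeff q n * u)
      q′ = q +ₚ s *ₚ p n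

      coeff-q′ : ∀ m → coeff q′ m ≈ coeff q m + s * coeff (p n) m
      coeff-q′ m = trans (coeff-+ q _ m) (+-congˡ (coeff-* s (p n) m))

      q′-vanishes : ∀ {m} → n ℕ.≤ m → coeff q′ m ≈ 0#
      q′-vanishes {m} n≤m with ℕ.m≤n⇒m<n∨m≡n n≤m
      ... | inj₁ n<m = begin
        coeff q′ m                     ≈⟨ coeff-q′ m ⟩
        coeff q m + s * coeff (p n) m  ≈⟨ +-cong (q≈0 n<m) (*-congˡ (deg n n<m)) ⟩
        0# + s * 0#                    ≈⟨ trans (+-identityˡ _) (zeroʳ s) ⟩
        0#                             ∎
      ... | inj₂ ≡.refl = begin
        coeff q′ n                                 ≈⟨ coeff-q′ n ⟩
        coeff q n + s * coeff (p n) n              ≈⟨ +-congˡ (-‿distribˡ-* _ _) ⟨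
        coeff q n - coeff q n * u * coeff (p n) n  ≈⟨ +-congˡ (-‿cong (*-assoc _ _ _)) ⟩
        coeff q n - coeff q n * (u * coeff (p n) n) ≈⟨ +-congˡ (-‿cong (*-congˡ u*lead≈1)) ⟩
        coeff q n - coeff q n * 1#                 ≈⟨ +-congˡ (-‿cong (*-identityʳ _)) ⟩
        coeff q n - coeff q n                      ≈⟨ -‿inverseʳ _ ⟩
        0#                                         ∎

  module Binomial (p : ℕ → Poly) (binomial : IsBinomial p) (p≉0 : ¬ (p ≈ₚₛ 0ₚₛ)) where

    -- Scalar series acting on e, and the derivative of e

    infixr 7 _⊛_
    -- The product f(t) F(x,t). The summation index follows `F` rather than `f`, so that shifting
    -- `F` by t merely drops the term k = 0 and `⊛-t·` holds by computation.
    _⊛_ : Series Carrier → Series Poly → Series Poly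
    (f ⊛ F) n = sumₚ {suc n} λ k → f (n ℕ.∸ toℕ k) *ₚ F (toℕ k)

    coeff-⊛ : ∀ f F n m → coeff ((f ⊛ F) n) m ≈
      sum {suc n} λ k → f (n ℕ.∸ toℕ k) * coeff (F (toℕ k)) m
    coeff-⊛ f F n m = trans (coeff-sum (λ (k : Fin (suc n)) → f (n ℕ.∸ toℕ k) *ₚ F (toℕ k)) m)
      (sum-cong-≋ {suc n} λ k → coeff-* (f (n ℕ.∸ toℕ k)) (F (toℕ k)) m)

    coeffs : ℕ → Series Carrier
    coeffs m n = coeff (p n) m

    -- For fixed x, both sides of e(x,t) e(y,t) = e(x+y,t) are polynomials in y in each degree of t,
    -- with equal values and hence equal coefficients. The coefficient of yᵐ on the left is e(x,t)
    -- times that of e(y,t).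
    coeff-E^-binomial : ∀ x n m → coeff (E^ x (p n)) m ≈ eval ((coeffs m ⊛ p) n) x
    coeff-E^-binomial x n m = begin
      coeff (E^ x (p n)) m
        ≈⟨ eval-injective (E^ x (p n)) (sumₚ {suc n} summand) expansion m ⟩
      coeff (sumₚ {suc n} summand) m
        ≈⟨ coeff-sum {suc n} summand m ⟩
      sum {suc n} (λ k → coeff (summand k) m)
        ≈⟨ sum-cong-≋ {suc n} (λ k → trans (coeff-* (eval (p (toℕ k)) x) (p (n ℕ.∸ toℕ k)) m)
             (trans (*-comm _ _) (sym (eval-* (coeffs m (n ℕ.∸ toℕ k)) (p (toℕ k)) x)))) ⟩
      sum {suc n} (λ k → eval (coeffs m (n ℕ.∸ toℕ k) *ₚ p (toℕ k)) x)
        ≈⟨ eval-sum {suc n} (λ k → coeffs m (n ℕ.∸ toℕ k) *ₚ p (toℕ k)) x ⟨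
      eval ((coeffs m ⊛ p) n) x ∎
      where
      summand : Fin (suc n) → Poly
      summand k = eval (p (toℕ k)) x *ₚ p (n ℕ.∸ toℕ k)

      expansion : ∀ y → eval (E^ x (p n)) y ≈ eval (sumₚ {suc n} summand) y
      expansion y = begin
        eval (E^ x (p n)) y             ≈⟨ eval-E^ x (p n) y ⟩
        eval (p n) (y + x)              ≈⟨ eval-congʳ (p n) (+-comm y x) ⟩
        eval (p n) (x + y)              ≈⟨ binomial x y n ⟨
        ((p at x) *ₛ (p at y)) n        ≈⟨ sum-cong-≋ {suc n} (λ k → eval-* (eval (p (toℕ k)) x) (p (n ℕ.∸ toℕ k)) y) ⟨
        sum {suc n} (λ k → eval (summand k) y) ≈⟨ eval-sum {suc n} summand y ⟨
        eval (sumₚ {suc n} summand) y   ∎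

    -- The case m = 0, that is, e = e(0,t) e.
    reproduces : ∀ n → p n ≈ₚ (coeffs 0 ⊛ p) n
    reproduces n = eval-injective (p n) ((coeffs 0 ⊛ p) n) λ x →
      trans (sym (coeff₀-E^ x (p n))) (coeff-E^-binomial x n 0)

    -- The case m = 1, that is, D e = f(t) e with f = `coeffs 1`.
    D-binomial : ∀ n → D (p n) ≈ₚ (coeffs 1 ⊛ p) n
    D-binomial n = eval-injective (D (p n)) ((coeffs 1 ⊛ p) n) λ x →
      trans (sym (coeff₁-E^ x (p n))) (coeff-E^-binomial x n 1)

    -- Vanishing and degree bounds

    ⊛-vanishes : ∀ f n m → f 0 * coeff (p n) m ≈ 0# →
      (∀ {k} → k ℕ.< n → coeff (p k) m ≈ 0#) → coeff ((f ⊛ p) n) m ≈ 0#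
    ⊛-vanishes f n m last≈0 init≈0 = trans (coeff-⊛ f p n m) (sum-zero {suc n} λ k → term (toℕ≤pred[n] k))
      where
      term : ∀ {k} → k ℕ.≤ n → f (n ℕ.∸ k) * coeff (p k) m ≈ 0#
      term {k} k≤n with ℕ.m≤n⇒m<n∨m≡n k≤n
      ... | inj₁ k<n    = trans (*-congˡ (init≈0 k<n)) (zeroʳ _)
      -- Only the term k = n involves f 0 and p n. It has a hypothesis of its own because a strong
      -- induction on n controls only k < n.
      ... | inj₂ ≡.refl = trans (*-congʳ (reflexive (≡.cong f (ℕ.n∸n≡0 n)))) last≈0

    -- If p₀ = 0, then e(0,t) has no constant term, so e = e(0,t) e expresses each pₙ through
    -- earlier ones and e = 0 by induction.
    p₀≉0 : ¬ (p 0 ≈ₚ [])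
    p₀≉0 p₀≈0 = p≉0 (<-rec (λ n → p n ≈ₚ []) λ n p≈0 m → trans (reproduces n m)
      (⊛-vanishes (coeffs 0) n m (trans (*-congʳ (p₀≈0 0)) (zeroˡ _)) (λ k<n → p≈0 k<n m)))

    -- By tightness it suffices to refute an invertible f₀. The constant term in t of D e = f e is D
    -- p₀ = f₀ p₀, which would then force p₀ = 0.
    f₀≈0 : coeff (p 0) 1 ≈ 0#
    f₀≈0 = proj₁ (tight _ _) λ f₀#0 → p₀≉0 (p₀-vanishes (#0⇒invertible f₀#0))
      where
      f₀ = coeff (p 0) 1

      recurrence : ∀ m → f₀ * coeff (p 0) m ≈ ι (suc m) * coeff (p 0) (suc m)
      recurrence m = begin
        f₀ * coeff (p 0) m               ≈⟨ +-identityʳ _ ⟨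
        f₀ * coeff (p 0) m + 0#          ≈⟨ coeff-⊛ (coeffs 1) p 0 m ⟨
        coeff ((coeffs 1 ⊛ p) 0) m       ≈⟨ D-binomial 0 m ⟨
        coeff (D (p 0)) m                ≈⟨ coeff-D (p 0) m ⟩
        ι (suc m) * coeff (p 0) (suc m)  ∎

      p₀-vanishes : (∃ λ u → u * f₀ ≈ 1#) → p 0 ≈ₚ []
      p₀-vanishes (_ , u*f₀≈1) m = vanishes (length (p 0)) m (ℕ.m≤m+n _ _)
        where
        -- Descending induction on m from the length of p₀, with d bounding the remaining distance.
        vanishes : ∀ d m → length (p 0) ℕ.≤ d ℕ.+ m → coeff (p 0) m ≈ 0#
        vanishes zero    m bound = coeff-vanishes (p 0) bound
        vanishes (suc d) m bound = *-cancelˡ-invertible u*f₀≈1 (begin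
          f₀ * coeff (p 0) m               ≈⟨ recurrence m ⟩
          ι (suc m) * coeff (p 0) (suc m)  ≈⟨ *-congˡ (vanishes d (suc m)
                                                (ℕ.≤-trans bound (ℕ.≤-reflexive (≡.sym (ℕ.+-suc d m))))) ⟩
          ι (suc m) * 0#                   ≈⟨ zeroʳ _ ⟩
          0#                               ≈⟨ zeroʳ f₀ ⟨
          f₀ * 0#                          ∎)

    -- As f₀ = 0, D pₙ is a combination of earlier pₖ and so has degree below n; in characteristic
    -- zero pₙ then has degree at most n.
    degree≤ : ∀ n {m} → n ℕ.< m → coeff (p n) m ≈ 0#
    degree≤ = <-rec (λ n → ∀ {m} → n ℕ.< m → coeff (p n) m ≈ 0#) λ { n below {suc m} (s≤s n≤m) →
      *-cancelˡ-invertible (proj₂ (ι-invertible m)) (begin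
        ι (suc m) * coeff (p n) (suc m)  ≈⟨ coeff-D (p n) m ⟨
        coeff (D (p n)) m                ≈⟨ D-binomial n m ⟩
        coeff ((coeffs 1 ⊛ p) n) m       ≈⟨ ⊛-vanishes (coeffs 1) n m
                                              (trans (*-congʳ f₀≈0) (zeroˡ _))
                                              (λ k<n → below k<n (ℕ.<-≤-trans k<n n≤m)) ⟩
        0#                               ≈⟨ zeroʳ _ ⟨
        ι (suc m) * 0#                   ∎) }

    -- Linear operators with eigenfunction e

    module _ {θ : Poly → Poly} (linear : IsLinear θ) (eigen : θ ⟨ p ⟩ ≈ₚₛ t· p) where
      open Linear linear

      θ-⊛ : ∀ f F n → θ ((f ⊛ F) n) ≈ₚ (f ⊛ (θ ⟨ F ⟩)) n
      θ-⊛ f F n m = begin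
        coeff (θ ((f ⊛ F) n)) m                     ≈⟨ T-sum {suc n} summand m ⟩
        coeff (sumₚ {suc n} (θ ∘ summand)) m         ≈⟨ coeff-sum {suc n} (θ ∘ summand) m ⟩
        sum {suc n} (λ k → coeff (θ (summand k)) m)  ≈⟨ sum-cong-≋ {suc n} (λ k → *ₗ-homo (f (n ℕ.∸ toℕ k)) (F (toℕ k)) m) ⟩
        sum {suc n} (λ k → coeff (f (n ℕ.∸ toℕ k) *ₚ θ (F (toℕ k))) m) ≈⟨ coeff-sum {suc n} (λ k → f (n ℕ.∸ toℕ k) *ₚ θ (F (toℕ k))) m ⟨
        coeff ((f ⊛ (θ ⟨ F ⟩)) n) m                 ∎
        where
        summand : Fin (suc n) → Poly
        summand k = f (n ℕ.∸ toℕ k) *ₚ F (toℕ k)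

      ⊛-cong : ∀ f F G → F ≈ₚₛ G → f ⊛ F ≈ₚₛ f ⊛ G
      ⊛-cong f F G F≈G n m = trans (coeff-⊛ f F n m) (trans
        (sum-cong-≋ {suc n} λ k → *-congˡ {f (n ℕ.∸ toℕ k)} (F≈G (toℕ k) m)) (sym (coeff-⊛ f G n m)))

      ⊛-t· : ∀ f F → f ⊛ (t· F) ≈ₚₛ t· (f ⊛ F)
      ⊛-t· f F zero    m = refl
      ⊛-t· f F (suc n) m = refl

      -- Coefficientwise form of θ D e = θ (f e) = f θ e = f t e = t D e = D (t e) = D θ e.
      θD≈Dθ-on-p : ∀ n → θ (D (p n)) ≈ₚ D (θ (p n))
      θD≈Dθ-on-p n m = begin
        coeff (θ (D (p n))) m                   ≈⟨ T-cong _ _ (D-binomial n) m ⟩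
        coeff (θ ((coeffs 1 ⊛ p) n)) m          ≈⟨ θ-⊛ (coeffs 1) p n m ⟩
        coeff ((coeffs 1 ⊛ (θ ⟨ p ⟩)) n) m      ≈⟨ ⊛-cong (coeffs 1) (θ ⟨ p ⟩) (t· p) eigen n m ⟩
        coeff ((coeffs 1 ⊛ (t· p)) n) m         ≈⟨ ⊛-t· (coeffs 1) p n m ⟩
        coeff ((t· (coeffs 1 ⊛ p)) n) m         ≈⟨ D-t· n m ⟨
        coeff (D ((t· p) n)) m                  ≈⟨ D-cong (θ (p n)) ((t· p) n) (eigen n) m ⟨
        coeff (D (θ (p n))) m                   ∎
        where
        D-t· : ∀ n → D ((t· p) n) ≈ₚ (t· (coeffs 1 ⊛ p)) n
        D-t· zero    m = refl
        D-t· (suc n) m = D-binomial n m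

      θ^ : ℕ → Poly → Poly
      θ^ zero    q = q
      θ^ (suc n) q = θ^ n (θ q)

      θ^-coeff-linear : ∀ n m → LinearFunctional (λ q → coeff (θ^ n q) m)
      θ^-coeff-linear zero    m = coeff-linear m
      θ^-coeff-linear (suc n) m = ∘-linear (θ^-coeff-linear n m) linear

      θ^-kills : ∀ {n k} → k ℕ.< n → θ^ n (p k) ≈ₚ []
      θ^-kills {suc n} {zero}  _         m =
        trans (cong (θ^-coeff-linear n m) (θ (p 0)) [] (eigen 0)) (zero-homo (θ^-coeff-linear n m))
      θ^-kills {suc n} {suc k} (s≤s k<n) m =
        trans (cong (θ^-coeff-linear n m) _ _ (eigen (suc k))) (θ^-kills k<n m)

      θ^-lowers : ∀ n → θ^ n (p n) ≈ₚ p 0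
      θ^-lowers zero    m = refl
      θ^-lowers (suc n) m =
        trans (cong (θ^-coeff-linear n m) _ _ (eigen (suc n))) (θ^-lowers n m)

      -- Otherwise pₙ has degree below n and lies under the reach of `spans` for p₀, ..., pₙ₋₁.
      -- Every coefficient of θⁿ vanishes on these, so θⁿ pₙ = 0, whereas θⁿ pₙ = p₀.
      leading≉0 : ∀ n → ¬ (coeff (p n) n ≈ 0#)
      leading≉0 = <-rec (λ n → ¬ (coeff (p n) n ≈ 0#)) λ n below lead≈0 → p₀≉0 λ m →
        trans (sym (θ^-lowers n m))
          (spans p degree≤ (θ^-coeff-linear n m) n below (λ k<n → θ^-kills k<n m) (p n) (degree< n lead≈0))
        where
        degree< : ∀ n → coeff (p n) n ≈ 0# → ∀ {m} → n ℕ.≤ m → coeff (p n) m ≈ 0#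
        degree< n lead≈0 n≤m with ℕ.m≤n⇒m<n∨m≡n n≤m
        ... | inj₁ n<m    = degree≤ n n<m
        ... | inj₂ ≡.refl = lead≈0

      θ-commute-D : Commute θ D
      θ-commute-D q m = x∙y⁻¹≈ε⇒x≈y _ _ (trans (+-congˡ (sym (-1*x≈-x _)))
        (spans p degree≤
          -- The functional is the coefficient of xᵐ in θ D - D θ; it vanishes on every pₖ, and
          -- `length q` exceeds the degree of q.
          (-‿linear (∘D-linear (∘-linear (coeff-linear m) linear))
                    (∘-linear (∘D-linear (coeff-linear m)) linear))
          (length q) (λ {k} _ → leading≉0 k)
          (λ {k} _ → trans (+-congˡ (-1*x≈-x _)) (x≈y⇒x∙y⁻¹≈ε (θD≈Dθ-on-p k m)))
          q (coeff-vanishes q)))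

mainTheorem6 : ∀ {c ℓ₁ ℓ₂} (K : HeytingField c ℓ₁ ℓ₂) (charZero : CharacteristicZero K) →
    let open HeytingField K using (Carrier)
        open Operators K charZero
    in
    (b : ℕ → Poly) →
    IsBinomial (egf b) →
    (θ : Poly → Poly) → IsLinear θ →
    IsEigenfunction-t θ (egf b) →
    Commute θ D
    × Commute θ E
    × (∀ (T : Poly → Poly) → IsLinear T → Commute T D ⇔ Commute T E)
    × (∀ (y : Carrier) → θ ⟨ E^ y ⟨ egf b ⟩ ⟩ ≈ₚₛ E^ y ⟨ θ ⟨ egf b ⟩ ⟩)
    × (∀ (y : Carrier) → Commute θ (E^ y))
    × (∀ (y : Carrier) (F : Series Poly) → θ ⟨ E^ y ⟨ F ⟩ ⟩ ≈ₚₛ E^ y ⟨ θ ⟨ F ⟩ ⟩)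
mainTheorem6 K charZero b binomial θ linear (e≉0 , eigen) =
    θD≈Dθ
  , θE^≈E^θ 1#
  , (λ T T-linear → mk⇔
      (λ TD≈DT → commute-D⇒commute-E^ K charZero T-linear TD≈DT 1#)
      (commute-E⇒commute-D K charZero T-linear))
  -- Operators act coefficientwise in t, so series identities are instances of commutation on single
  -- polynomials.
  , (λ y n → θE^≈E^θ y (egf b n))
  , θE^≈E^θ
  , (λ y F n → θE^≈E^θ y (F n))
  where
  open HeytingField K using (1#)
  open Operators K charZero

  θD≈Dθ : Commute θ D
  θD≈Dθ = Binomial.θ-commute-D K charZero (egf b) binomial e≉0 linear eigen

  θE^≈E^θ : ∀ y → Commute θ (E^ y)
  θE^≈E^θ = commute-D⇒commute-E^ K charZero linear θD≈Dθ
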